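{- Let $\kappa$ be an infinite cardinal, and let $\mathcal{L}\subsetneq\mathrm{Lin}_\kappa$ be nonempty and downward $\preceq$-closed and such that $\trianglelefteq^{\mathcal{L}}_\kappa$ is transitive. Then there is a family $\mathcal{F}\subseteq\mathrm{LO}_\kappa$ of size $\kappa^+$ which is unbounded with respect to $\trianglelefteq^{\mathcal{L}}_\kappa$. Thus $\mathfrak{b}(\trianglelefteq^{\mathcal{L}}_\kappa)=\kappa^+$.
   Context: Linear orders are reflexive and nonempty; $L\preceq L'$ means there is an embedding $f:L\to L'$, i.e. $x\le_L y\iff f(x)\le_{L'}f(y)$. For a cardinal $\kappa$, $\mathrm{LO}_\kappa$ is the set of (codes for) linear orders with domain $\kappa$, and $\mathrm{Lin}_\kappa=\bigcup_{0<\lambda\le\kappa}\mathrm{LO}_\lambda$ ($\lambda$ ranging over cardinals), i.e. the nonempty linear orders of size at most $\kappa$. $\mathcal{L}\subseteq\mathrm{Lin}_\kappa$ is downward $\preceq$-closed if $K\in\mathrm{Lin}_\kappa$, $K\preceq L\in\mathcal{L}$ imply $K\in\mathcal{L}$; membership is meant up to isomorphism. A subset $I$ of $L$ is convex if $x\le_L y\le_L z$ and $x,z\in I$ imply $y\in I$. A $K$-convex partition of $L$ is a partition $(L_k)_{k\in K}$ of $L$ (into nonempty sets) such that $k<_K k'\iff$ every element of $L_k$ is $<_L$ every element of $L_{k'}$. $L\trianglelefteq^{\mathcal{L}}L'$ iff there are $K\in\mathcal{L}$, a $K$-convex partition $(L_k)_{k\in K}$ of $L$, and an embedding $f$ of $L$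 into $L'$ such that each $f(L_k)$ is a convex subset of $L'$. $\trianglelefteq^{\mathcal{L}}_\kappa$ is the restriction of $\trianglelefteq^{\mathcal{L}}$ to $\mathrm{LO}_\kappa$. For a quasi-order $\precsim$ on $X$, $\mathcal{F}\subseteq X$ is unbounded if there is no $x\in X$ with $y\precsim x$ for all $y\in\mathcal{F}$; the unbounding number $\mathfrak{b}(\precsim)$ is the least size of an unbounded subset of $X$. -}

module Defs where

open import Data.Nat.Base using (ℕ)
open import Data.Product.Base using (Σ-syntax; ∃-syntax; _×_; _,_)
open import Data.Refinement using (Refinement-syntax)
open import Function.Base using (id)
open import Function.Bundles using (_⇔_; _↣_; _⤖_; mk⇔; Equivalence)
open import Function.Definitions using (Injective)
open import Induction.WellFounded using (WellFounded)
open import Level using (Level; 0ℓ; suc; _⊔_)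
open import Relation.Binary.Bundles using (Setoid)
open import Relation.Binary.Core using (Rel)
open import Relation.Binary.PropositionalEquality.Core using (_≡_)
open import Relation.Binary.Structures using (IsStrictTotalOrder; IsTotalOrder)
open import Relation.Nullary.Negation.Core using (¬_)
open import Relation.Unary using (Pred; _∈_)
import Relation.Binary.Construct.NonStrictToStrict as ToStrict

private
  variable
    a ℓ ℓ₁ ℓ₂ : Level
    A B : Set

-- Cardinals are initial ordinals: well-ordered types that are not equinumerous
-- with any proper initial segment.  Segments are refinement types, so that
-- their elements are points below x, whatever the proofs of y < x are.

record Cardinal : Set₁ where
  infix 4 _<_
  field
    Carrier            : Set
    _<_                : Rel Carrier 0ℓ
    isStrictTotalOrder : IsStrictTotalOrder _≡_ _<_
    <-wellFounded      : WellFounded _<_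
    initial            : ∀ x → ¬ (Carrier ⤖ [ y ∈ Carrier ∣ y < x ])

∣_∣ : Cardinal → Set
∣ κ ∣ = Cardinal.Carrier κ

infix 4 _≤ᶜ_ _<ᶜ_

_≤ᶜ_ : Rel Cardinal 0ℓ
κ ≤ᶜ μ = ∣ κ ∣ ↣ ∣ μ ∣

_<ᶜ_ : Rel Cardinal 0ℓ
κ <ᶜ μ = κ ≤ᶜ μ × ¬ (μ ≤ᶜ κ)

Infinite : Cardinal → Set
Infinite κ = ℕ ↣ ∣ κ ∣

_IsSuccessorOf_ : Rel Cardinal (suc 0ℓ)
κ⁺ IsSuccessorOf κ = κ <ᶜ κ⁺ × (∀ μ → κ <ᶜ μ → κ⁺ ≤ᶜ μ)

record LO (A : Set) : Set₁ where
  infix 4 _≤_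
  field
    _≤_          : Rel A 0ℓ
    isTotalOrder : IsTotalOrder _≡_ _≤_

  open ToStrict _≡_ _≤_ public using (_<_)

-- Two orders on the same domain are the same code when their relations have
-- the same extension.

LO-setoid : Set → Setoid (suc 0ℓ) 0ℓ
LO-setoid A = record
  { Carrier       = LO A
  ; _≈_           = λ L L′ → ∀ x y → LO._≤_ L x y ⇔ LO._≤_ L′ x y
  ; isEquivalence = record
    { refl  = λ x y → mk⇔ id id
    ; sym   = λ e x y → mk⇔ (Equivalence.from (e x y)) (Equivalence.to (e x y))
    ; trans = λ e f x y → mk⇔
        (λ p → Equivalence.to (f x y) (Equivalence.to (e x y) p))
        (λ p → Equivalence.from (e x y) (Equivalence.from (f x y) p))
    }
  }

IsEmbedding : LO A → LO B → (A → B) → Set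
IsEmbedding L L′ f = ∀ x y → (LO._≤_ L x y) ⇔ (LO._≤_ L′ (f x) (f y))

infix 4 _⪯_

_⪯_ : LO A → LO B → Set
L ⪯ L′ = ∃[ f ] IsEmbedding L L′ f

record Lin (κ : Cardinal) : Set₁ where
  field
    size     : Cardinal
    size≤κ   : size ≤ᶜ κ
    nonempty : ∣ size ∣
    order    : LO ∣ size ∣

DownwardClosed : ∀ {κ} → Pred (Lin κ) ℓ → Set (suc 0ℓ ⊔ ℓ)
DownwardClosed 𝓛 = ∀ K L → Lin.order K ⪯ Lin.order L → L ∈ 𝓛 → K ∈ 𝓛

Convex : LO A → Pred A 0ℓ → Set
Convex L I = ∀ x y z → x ≤ y → y ≤ z → x ∈ I → z ∈ I → y ∈ I
  where open LO L

record IsConvexPartition (K : LO B) (L : LO A) (P : B → Pred A 0ℓ) : Set where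
  field
    nonempty : ∀ k → ∃[ x ] x ∈ P k
    covers   : ∀ x → ∃[ k ] x ∈ P k
    disjoint : ∀ k k′ x → x ∈ P k → x ∈ P k′ → k ≡ k′
    ordered  : ∀ k k′ →
      LO._<_ K k k′ ⇔ (∀ x y → x ∈ P k → y ∈ P k′ → LO._<_ L x y)

Image : (A → B) → Pred A 0ℓ → Pred B 0ℓ
Image f I y = ∃[ x ] (x ∈ I × f x ≡ y)

infix 4 _⊴[_]_

_⊴[_]_ : ∀ {κ} → LO A → Pred (Lin κ) ℓ → LO B → Set (suc 0ℓ ⊔ ℓ)
_⊴[_]_ {A = A} {B = B} {κ = κ} L 𝓛 L′ =
  Σ[ K ∈ Lin κ ] K ∈ 𝓛 ×
  (Σ[ P ∈ (∣ Lin.size K ∣ → Pred A 0ℓ) ] IsConvexPartition (Lin.order K) L P ×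
  (Σ[ f ∈ (A → B) ] IsEmbedding L L′ f × (∀ k → Convex L′ (Image f (P k)))))

⊴-on : ∀ κ → Pred (Lin κ) ℓ → Rel (LO ∣ κ ∣) (suc 0ℓ ⊔ ℓ)
⊴-on κ 𝓛 L L′ = L ⊴[ 𝓛 ] L′

-- Since e is onto 𝓕 up to _≈_, HasSize 𝓕 μ forces 𝓕 to respect _≈_ and counts
-- its elements up to _≈_.

module _ (X : Setoid a ℓ₁) where
  open Setoid X using (_≈_) renaming (Carrier to ∣X∣)

  HasSize : Pred ∣X∣ 0ℓ → Cardinal → Set (a ⊔ ℓ₁)
  HasSize 𝓕 μ = Σ[ e ∈ (∣ μ ∣ → ∣X∣) ]
    Injective _≡_ _≈_ e × (∀ x → x ∈ 𝓕 ⇔ (∃[ i ] e i ≈ x))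

  Unbounded : Rel ∣X∣ ℓ₂ → Pred ∣X∣ 0ℓ → Set (a ⊔ ℓ₂)
  Unbounded _≲_ 𝓕 = ¬ (∃[ x ] (∀ y → y ∈ 𝓕 → y ≲ x))

  UnboundingNumber : Rel ∣X∣ ℓ₂ → Cardinal → Set (suc 0ℓ ⊔ a ⊔ ℓ₁ ⊔ ℓ₂)
  UnboundingNumber _≲_ μ =
    (Σ[ 𝓕 ∈ Pred ∣X∣ 0ℓ ] HasSize 𝓕 μ × Unbounded _≲_ 𝓕) ×
    (∀ ν (𝓖 : Pred ∣X∣ 0ℓ) → HasSize 𝓖 ν → Unbounded _≲_ 𝓖 → μ ≤ᶜ ν)

{-# OPTIONS --safe #-}
module Submission where

-- Fix an order M of size at most κ outside 𝓛.
--
-- Small families are bounded.  The sum of at most κ orders on κ, indexed by a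
-- well-order, lives on a set that injects into κ × κ, hence into κ, and becomes
-- an order on κ after appending the unused points of κ (`sum-bounds`).  Every
-- summand is convex in it, and the one-piece partition is available because 𝓛
-- is nonempty and downward closed (`⊑⇒⊴`).  A cardinal that κ⁺ does not inject
-- into injects into a proper segment of κ⁺ (`compare`), hence into κ
-- (`successor-segment`).
--
-- The unbounded family.  For x in κ⁺ let B x be the order 1 + x + ω*, where x
-- also denotes the order type of the segment below x, and let the member at x
-- begin with M copies of B x.  If the member at x is piecewise convexly embedded
-- in L by way of 𝓛, then the pieces cannot separate the least points of the M
-- copies, as otherwise M would embed into an order of 𝓛.  So a piece contains
-- two of these least points, hence the whole copy of B x between them, and B x
-- has a convex copy in L (`summand-survives`).  The point of L at which a convex
-- copy of B x starts determines x: two convex copies with the same start run in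
-- parallel, and the first to leave its well-ordered part descends along ω* where
-- the other has a next point (`start-determines`).  So a common bound L on κ
-- would give an injection of κ⁺ into κ.  The same lemma shows that members with
-- different indices are different orders, since the start of the copy of B x at
-- a fixed point of M is coded in κ independently of x.
--
-- The injection of κ × κ into κ comes from Gödel's well-order of the square of
-- an infinite segment of κ⁺ (`segment-square`), after κ has been injected into
-- such a segment (`square`).

open import Defs
open import Axiom.ExcludedMiddle using (ExcludedMiddle)
open import Data.Empty using (⊥)
open import Data.Irrelevant using ([_])
open import Data.Maybe.Base using (Maybe; just; nothing)
open import Data.Nat.Base as ℕ using (ℕ; zero; suc)
import Data.Nat.Induction as ℕ
import Data.Nat.Properties as ℕ
open import Data.Product.Base using (Σ-syntax; ∃; ∃-syntax; _×_; _,_; proj₁; proj₂)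
open import Data.Product.Function.NonDependent.Propositional using (_×-↣_)
open import Data.Product.Relation.Binary.Lex.Strict using (×-Lex; ×-wellFounded)
open import Data.Refinement using (Refinement-syntax; value; _,_)
open import Data.Refinement.Properties using (value-injective)
open import Data.Sum.Base using (_⊎_; inj₁; inj₂; map₁; map₂)
open import Data.Sum.Properties using (inj₁-injective; inj₂-injective)
open import Data.Sum.Relation.Binary.LeftOrder using (_⊎-<_; ₁∼₁; ₁∼₂; ₂∼₂; drop-inj₁; ⊎-<-isTotalOrder)
open import Data.Sum.Relation.Binary.Pointwise using (Pointwise-≡⇒≡)
open import Data.Unit.Base using (⊤; tt)
open import Function.Base using (_∘_; _on_; case_of_)
open import Function.Bundles using (Injection; _↣_; _⤖_; mk↣; mk⤖; mk⇔; module Equivalence; module Bijection)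
open import Function.Construct.Identity using (↣-id)
open import Function.Properties.Injection using (↣-trans)
open import Induction.WellFounded using (WellFounded; Acc; acc; wf⇒asym)
open import Level using (0ℓ; Level)
open import Relation.Binary.Bundles using (Setoid)
open import Relation.Binary.Core using (Rel)
open import Relation.Binary.Definitions using (Transitive; Trichotomous; tri<; tri≈; tri>)
import Relation.Binary.Construct.Flip.EqAndOrd as Flip
import Relation.Binary.Construct.NonStrictToStrict as ToStrict
import Relation.Binary.Construct.On as On
open import Relation.Binary.PropositionalEquality.Core using (_≡_; _≢_; refl; sym; trans; cong; cong₂; subst; resp₂)
open import Relation.Binary.PropositionalEquality.Properties using (isEquivalence)
open import Relation.Binary.Structures using (IsStrictTotalOrder; IsTotalOrder)
open import Relation.Nullary.Decidable.Core using (Dec; yes; no; recompute; decidable-stable)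
open import Relation.Nullary.Negation.Core using (¬_; contradiction)
open import Relation.Unary using (Pred; U; _⊂_; _∈_; _∉_; Satisfiable)

open Injection using (to; injective)

private
  variable
    A B C : Set

-- Well-orders

-- A well-founded connex relation.  Irreflexivity, asymmetry and transitivity
-- all follow from the absence of short cycles.
record WellOrder (A : Set) : Set₁ where
  infix 4 _<_
  field
    _<_         : Rel A 0ℓ
    connex      : ∀ x y → x < y ⊎ x ≡ y ⊎ y < x
    wellFounded : WellFounded _<_

  asym : ∀ {x y} → x < y → ¬ y < x
  asym = wf⇒asym wellFounded

  irrefl : ∀ {x} → ¬ x < x
  irrefl x<x = asym x<x x<x

  private
    no-cycle : ∀ {x y z} → Acc _<_ x → x < y → y < z → ¬ z < x
    no-cycle (acc rs) x<y y<z z<x = no-cycle (rs z<x) z<x x<y y<z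

  <-trans : Transitive _<_
  <-trans {x} {y} {z} x<y y<z with connex x z
  ... | inj₁ x<z         = x<z
  ... | inj₂ (inj₁ refl) = contradiction y<z (asym x<y)
  ... | inj₂ (inj₂ z<x)  = contradiction z<x (no-cycle (wellFounded x) x<y y<z)

open WellOrder using (connex; wellFounded)

infix 5 _↾_

-- The initial segment of the points below x.
_↾_ : WellOrder A → A → Set
_↾_ {A} W x = [ y ∈ A ∣ WellOrder._<_ W y x ]

compare⇒connex : {_<_ : Rel A 0ℓ} → Trichotomous _≡_ _<_ → ∀ x y → x < y ⊎ x ≡ y ⊎ y < x
compare⇒connex compare x y with compare x y
... | tri< x<y _ _ = inj₁ x<y
... | tri≈ _ x≡y _ = inj₂ (inj₁ x≡y)
... | tri> _ _ y<x = inj₂ (inj₂ y<x)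

well-order : ∀ κ → WellOrder ∣ κ ∣
well-order κ = record
  { _<_         = κ._<_
  ; connex      = compare⇒connex (IsStrictTotalOrder.compare κ.isStrictTotalOrder)
  ; wellFounded = κ.<-wellFounded
  }
  where module κ = Cardinal κ

ℕ-wellOrder : WellOrder ℕ
ℕ-wellOrder = record
  { _<_         = ℕ._<_
  ; connex      = compare⇒connex ℕ.<-cmp
  ; wellFounded = ℕ.<-wellFounded
  }

pullback : WellOrder B → A ↣ B → WellOrder A
pullback W f = record
  { _<_         = W._<_ on to f
  ; connex      = λ x y → map₂ (map₁ (injective f)) (W.connex (to f x) (to f y))
  ; wellFounded = On.wellFounded (to f) W.wellFounded
  }
  where module W = WellOrder W

-- The lexicographic product, the first coordinate being the more significant.
_⊗_ : WellOrder A → WellOrder B → WellOrder (A × B)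
V ⊗ W = record
  { _<_         = ×-Lex _≡_ V._<_ W._<_
  ; connex      = connex′
  ; wellFounded = ×-wellFounded V.wellFounded W.wellFounded
  }
  where
  module V = WellOrder V
  module W = WellOrder W
  connex′ : ∀ p q → ×-Lex _≡_ V._<_ W._<_ p q ⊎ p ≡ q ⊎ ×-Lex _≡_ V._<_ W._<_ q p
  connex′ (x , y) (x′ , y′) with V.connex x x′ | W.connex y y′
  ... | inj₁ x<x′         | _                 = inj₁ (inj₁ x<x′)
  ... | inj₂ (inj₂ x′<x)  | _                 = inj₂ (inj₂ (inj₁ x′<x))
  ... | inj₂ (inj₁ refl) | inj₁ y<y′         = inj₁ (inj₂ (refl , y<y′))
  ... | inj₂ (inj₁ refl) | inj₂ (inj₁ refl) = inj₂ (inj₁ refl)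
  ... | inj₂ (inj₁ refl) | inj₂ (inj₂ y′<y)  = inj₂ (inj₂ (inj₂ (refl , y′<y)))

segment-order : (W : WellOrder A) (x : A) → WellOrder (W ↾ x)
segment-order W x = pullback W (mk↣ {to = value} value-injective)

module _ (W : WellOrder A) where
  open WellOrder W using (_<_; <-trans; irrefl; asym)

  segment-inclusion : ∀ {x y} → x < y → (W ↾ x) ↣ (W ↾ y)
  segment-inclusion x<y = mk↣ {to = λ (z , [ z<x ]) → z , [ <-trans z<x x<y ]}
    (value-injective ∘ cong value)

  -- The points of a segment of a segment form a segment.
  segment-segment : ∀ {x} (y : W ↾ x) → (segment-order W x ↾ y) ↣ (W ↾ value y)
  segment-segment y = mk↣ {to = λ (z , [ z<y ]) → value z , [ z<y ]}
    (value-injective ∘ value-injective ∘ cong value)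

  isStrictTotalOrder : IsStrictTotalOrder _≡_ _<_
  isStrictTotalOrder = record
    { isStrictPartialOrder = record
      { isEquivalence = isEquivalence
      ; irrefl        = λ { refl → irrefl }
      ; trans         = <-trans
      ; <-resp-≈      = resp₂ _<_
      }
    ; compare = compare
    }
    where
    compare : Trichotomous _≡_ _<_
    compare x y with connex W x y
    ... | inj₁ x<y         = tri< x<y (λ { refl → irrefl x<y }) (asym x<y)
    ... | inj₂ (inj₁ refl) = tri≈ irrefl refl irrefl
    ... | inj₂ (inj₂ y<x)  = tri> (asym y<x) (λ { refl → irrefl y<x }) y<x

-- Injections into products

ℕ-pairing : (ℕ × ℕ) ↣ ℕ
ℕ-pairing = mk↣ {to = pair} (λ {p} {q} → pair-injective p q)
  where
  -- pair (a , b) = 2 ^ a * (2 * b + 1)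
  pair : ℕ × ℕ → ℕ
  pair (zero  , b) = suc (2 ℕ.* b)
  pair (suc a , b) = 2 ℕ.* pair (a , b)

  pair-injective : ∀ p q → pair p ≡ pair q → p ≡ q
  pair-injective (zero , b) (zero , d) eq =
    cong (zero ,_) (ℕ.*-cancelˡ-≡ b d 2 (ℕ.suc-injective eq))
  pair-injective (zero , b) (suc c , d) eq =
    contradiction (sym eq) (ℕ.even≢odd (pair (c , d)) b)
  pair-injective (suc a , b) (zero , d) eq =
    contradiction eq (ℕ.even≢odd (pair (a , b)) d)
  pair-injective (suc a , b) (suc c , d) eq
    with refl ← pair-injective (a , b) (c , d)
                  (ℕ.*-cancelˡ-≡ (pair (a , b)) (pair (c , d)) 2 eq) = refl

-- Only two distinct points of A are needed: one tags the new point, the other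
-- the old ones.
Maybe-↣ : ℕ ↣ A → Maybe A ↣ (A × A)
Maybe-↣ {A} g = mk↣ {to = code} (λ {x} {y} → code-injective x y)
  where
  code : Maybe A → A × A
  code nothing  = to g 0 , to g 0
  code (just a) = to g 1 , a

  code-injective : ∀ x y → code x ≡ code y → x ≡ y
  code-injective nothing  nothing  eq = refl
  code-injective nothing  (just _) eq with () ← injective g (cong proj₁ eq)
  code-injective (just _) nothing  eq with () ← injective g (cong proj₁ eq)
  code-injective (just _) (just _) eq = cong just (cong proj₂ eq)

-- Linear orders

module _ (L : LO A) where
  open LO L using (_≤_; _<_; isTotalOrder)
  open IsTotalOrder isTotalOrder using (antisym)

  <⇒≱ : ∀ {x y} → x < y → ¬ y ≤ x
  <⇒≱ = ToStrict.<⇒≱ _≡_ _≤_ antisym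

≈⇒≡-isTotalOrder : {_≈_ _≤_ : Rel A 0ℓ} → (∀ {x y} → x ≈ y → x ≡ y) →
                   IsTotalOrder _≈_ _≤_ → IsTotalOrder _≡_ _≤_
≈⇒≡-isTotalOrder ≈⇒≡ O = record
  { isPartialOrder = record
    { isPreorder = record
      { isEquivalence = isEquivalence
      ; reflexive     = λ { refl → O.refl }
      ; trans         = O.trans
      }
    ; antisym = λ x≤y y≤x → ≈⇒≡ (O.antisym x≤y y≤x)
    }
  ; total = O.total
  }
  where module O = IsTotalOrder O

one : LO ⊤
one = record
  { _≤_          = λ _ _ → ⊤
  ; isTotalOrder = record
    { isPartialOrder = record
      { isPreorder = record { isEquivalence = isEquivalence ; reflexive = _ ; trans = _ }
      ; antisym    = λ _ _ → refl
      }
    ; total = λ _ _ → inj₁ tt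
    }
  }

-- A well-order as a reflexive linear order.
linear : WellOrder A → LO A
linear W = record
  { _≤_          = λ x y → x < y ⊎ x ≡ y
  ; isTotalOrder = record
    { isPartialOrder = record
      { isPreorder = record
        { isEquivalence = isEquivalence
        ; reflexive     = inj₂
        ; trans         = λ where
            (inj₁ x<y)  (inj₁ y<z)  → inj₁ (<-trans x<y y<z)
            (inj₁ x<y)  (inj₂ refl) → inj₁ x<y
            (inj₂ refl) y≤z         → y≤z
        }
      ; antisym = λ where
          (inj₁ x<y) (inj₁ y<x) → contradiction y<x (asym x<y)
          (inj₁ _)   (inj₂ y≡x) → sym y≡x
          (inj₂ x≡y) _          → x≡y
      }
    ; total = λ x y → case connex W x y of λ where
        (inj₁ x<y)        → inj₁ (inj₁ x<y)
        (inj₂ (inj₁ x≡y)) → inj₁ (inj₂ x≡y)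
        (inj₂ (inj₂ y<x)) → inj₂ (inj₁ y<x)
    }
  }
  where open WellOrder W using (_<_; <-trans; asym)

-- The natural numbers in reverse.
ω* : LO ℕ
ω* = record { _≤_ = ℕ._≥_ ; isTotalOrder = Flip.isTotalOrder ℕ.≤-isTotalOrder }

infixr 5 _⊕_

-- L followed by L′.
_⊕_ : LO A → LO B → LO (A ⊎ B)
L ⊕ L′ = record
  { _≤_          = LO._≤_ L ⊎-< LO._≤_ L′
  ; isTotalOrder = ≈⇒≡-isTotalOrder Pointwise-≡⇒≡
      (⊎-<-isTotalOrder (LO.isTotalOrder L) (LO.isTotalOrder L′))
  }

pullback-LO : LO B → A ↣ B → LO A
pullback-LO L f = record
  { _≤_          = LO._≤_ L on to f
  ; isTotalOrder = ≈⇒≡-isTotalOrder (injective f) (On.isTotalOrder (to f) (LO.isTotalOrder L))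
  }

-- Convex embeddings

infix 4 _⊑_

-- L ⊑ L′ consists of an embedding of L into L′ whose whole range is convex.
record _⊑_ (L : LO A) (L′ : LO B) : Set where
  private
    module L  = LO L
    module L′ = LO L′
  field
    map    : A → B
    embeds : IsEmbedding L L′ map
    convex : ∀ a c y → map a L′.≤ y → y L′.≤ map c → ∃[ b ] map b ≡ y

  mono : ∀ {a b} → a L.≤ b → map a L′.≤ map b
  mono = Equivalence.to (embeds _ _)

  reflect : ∀ {a b} → map a L′.≤ map b → a L.≤ b
  reflect = Equivalence.from (embeds _ _)

  map-injective : ∀ {a b} → map a ≡ map b → a ≡ b
  map-injective eq = IsTotalOrder.antisym L.isTotalOrder
    (reflect (IsTotalOrder.reflexive L′.isTotalOrder eq))
    (reflect (IsTotalOrder.reflexive L′.isTotalOrder (sym eq)))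

open _⊑_ using (map; convex)

⊑-trans : {L : LO A} {L′ : LO B} {L″ : LO C} → L ⊑ L′ → L′ ⊑ L″ → L ⊑ L″
⊑-trans f g = record
  { map    = map g ∘ map f
  ; embeds = λ x y → mk⇔ (g.mono ∘ f.mono) (f.reflect ∘ g.reflect)
  ; convex = λ a c y a≤y y≤c → case convex g _ _ y a≤y y≤c of λ where
      (z , refl) → case convex f a c z (g.reflect a≤y) (g.reflect y≤c) of λ where
        (b , refl) → b , refl
  }
  where
  module f = _⊑_ f
  module g = _⊑_ g

≈⇒⊑ : {L L′ : LO A} → Setoid._≈_ (LO-setoid A) L L′ → L ⊑ L′
≈⇒⊑ L≈L′ = record { map = λ x → x ; embeds = L≈L′ ; convex = λ _ _ y _ _ → y , refl }

-- Classical principles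

-- Since excluded middle decides every type, and not only propositions, it also
-- yields witnesses: `by-contradiction` at an existential acts as a choice
-- principle.
module Classical (em : ExcludedMiddle 0ℓ) where

  by-contradiction : {P : Set} → ¬ ¬ P → P
  by-contradiction = decidable-stable em

  ¬∀⇒∃¬ : {P : A → Set} → ¬ (∀ x → P x) → ∃[ x ] ¬ P x
  ¬∀⇒∃¬ ¬∀ = by-contradiction λ ¬∃ →
    ¬∀ λ x → by-contradiction λ ¬Px → ¬∃ (x , ¬Px)

  -- The bound of a point of a segment, recovered from its irrelevant proof.
  below : (W : WellOrder A) {x : A} (y : W ↾ x) → WellOrder._<_ W (value y) x
  below W (y , [ y<x ]) = recompute em y<x

  least : (W : WellOrder A) {P : Pred A 0ℓ} → ∃ P →
          ∃[ x ] P x × (∀ y → WellOrder._<_ W y x → ¬ P y)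
  least W {P} (x , Px) = go x (wellFounded W x) Px
    where
    open WellOrder W using (_<_)
    go : ∀ x → Acc _<_ x → P x → ∃[ x ] P x × (∀ y → y < x → ¬ P y)
    go x (acc rs) Px with em {∃[ y ] (y < x × P y)}
    ... | yes (y , y<x , Py) = go y (rs y<x) Py
    ... | no  ¬∃             = x , Px , λ y y<x Py → ¬∃ (y , y<x , Py)

  -- Comparability of well-orders

  module Comparison (V : WellOrder A) (W : WellOrder B) where
    private
      module V = WellOrder V
      module W = WellOrder W

    infix 4 _~_

    -- The segments below x and y are isomorphic: every point below one of them
    -- is matched with a point below the other.
    data _~_ (x : A) (y : B) : Set where
      match : (∀ x′ → x′ V.< x → ∃[ y′ ] (y′ W.< y × x′ ~ y′)) →
              (∀ y′ → y′ W.< y → ∃[ x′ ] (x′ V.< x × x′ ~ y′)) → x ~ y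

    ~-functional : ∀ {x y y′} → x ~ y → x ~ y′ → y ≡ y′
    ~-functional {x} = go (V.wellFounded x)
      where
      go : ∀ {x y y′} → Acc V._<_ x → x ~ y → x ~ y′ → y ≡ y′
      higher : ∀ {x y y′} → Acc V._<_ x → x ~ y → x ~ y′ → ¬ y W.< y′
      higher {y = y} (acc rs) (match f _) (match _ g) y<y′ =
        let x′ , x′<x , x′~y = g _ y<y′
            y″ , y″<y , x′~y″ = f x′ x′<x
        in W.irrefl (subst (W._< y) (go (rs x′<x) x′~y″ x′~y) y″<y)
      go {y = y} {y′} a x~y x~y′ with W.connex y y′
      ... | inj₁ y<y′        = contradiction y<y′ (higher a x~y x~y′)
      ... | inj₂ (inj₁ y≡y′) = y≡y′
      ... | inj₂ (inj₂ y′<y) = contradiction y′<y (higher a x~y′ x~y)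

    ~-strict : ∀ {x x′ y} → x ~ y → x′ ~ y → ¬ x V.< x′
    ~-strict {y = y} x~y (match f _) x<x′ =
      let y′ , y′<y , x~y′ = f _ x<x′
      in W.irrefl (subst (W._< y) (~-functional x~y′ x~y) y′<y)

    ~-injective : ∀ {x x′ y} → x ~ y → x′ ~ y → x ≡ x′
    ~-injective {x} {x′} x~y x′~y with V.connex x x′
    ... | inj₁ x<x′        = contradiction x<x′ (~-strict x~y x′~y)
    ... | inj₂ (inj₁ x≡x′) = x≡x′
    ... | inj₂ (inj₂ x′<x) = contradiction x′<x (~-strict x′~y x~y)

    -- If every point of A is matched, matching is an injection.  Otherwise all
    -- of B is matched below the least unmatched point of A.
    compare : (A ↣ B) ⊎ (∃[ x ] (B ↣ (V ↾ x)))
    compare with em {∀ x → ∃[ y ] x ~ y}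
    ... | yes partner = inj₁ (mk↣ {to = proj₁ ∘ partner} λ {x} {x′} eq →
      ~-injective (proj₂ (partner x)) (subst (x′ ~_) (sym eq) (proj₂ (partner x′))))
    ... | no  ¬∀ with x , ¬∃y , minimal ← least V {λ x → ¬ (∃[ y ] x ~ y)} (¬∀⇒∃¬ ¬∀) =
      inj₂ (x , mk↣ {to = λ y → proj₁ (partner y) , [ proj₁ (proj₂ (partner y)) ]}
        λ {y} {y′} eq → ~-functional (proj₂ (proj₂ (partner y)))
          (subst (_~ y′) (sym (cong value eq)) (proj₂ (proj₂ (partner y′)))))
      where
      partner : ∀ y → ∃[ x′ ] (x′ V.< x × x′ ~ y)
      partner = by-contradiction λ ¬∀y → ¬∃y (first-unmatched (least W (¬∀⇒∃¬ ¬∀y)))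
        where
        -- The least y that is not matched below x is matched with x.
        first-unmatched : ∃[ y ] (¬ (∃[ x′ ] (x′ V.< x × x′ ~ y))) ×
          (∀ y′ → y′ W.< y → ¬ ¬ (∃[ x′ ] (x′ V.< x × x′ ~ y′))) → ∃[ y ] x ~ y
        first-unmatched (y , unmatched , y-minimal) =
          y , match lower (λ y′ y′<y → by-contradiction (y-minimal y′ y′<y))
          where
          lower : ∀ x′ → x′ V.< x → ∃[ y′ ] (y′ W.< y × x′ ~ y′)
          lower x′ x′<x with y′ , x′~y′ ← by-contradiction (minimal x′ x′<x) | W.connex y′ y
          ... | inj₁ y′<y        = y′ , y′<y , x′~y′
          ... | inj₂ (inj₁ refl) = contradiction (x′ , x′<x , x′~y′) unmatched
          ... | inj₂ (inj₂ y<y′) with match _ g ← x′~y′ =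
            let x″ , x″<x′ , x″~y = g y y<y′
            in contradiction (x″ , V.<-trans x″<x′ x′<x , x″~y) unmatched

  open Comparison public using (compare)

  -- A Schröder–Bernstein theorem: an injection of A into its segment at x
  -- makes A equinumerous with that segment.
  module _ (W : WellOrder A) {x : A} (f : A ↣ (W ↾ x)) where
    private
      open WellOrder W using (_<_)

      -- The points reached from outside the segment by iterating f.
      data Orbit : A → Set where
        outside : ∀ {y} → ¬ y < x → Orbit y
        step    : ∀ {y z} → Orbit y → value (to f y) ≡ z → Orbit z

      shift : ∀ y → Dec (Orbit y) → W ↾ x
      shift y (yes _) = to f y
      shift y (no ¬o) = y , [ by-contradiction (¬o ∘ outside) ]

      shift-injective : ∀ y z o o′ → shift y o ≡ shift z o′ → y ≡ z
      shift-injective y z (yes _) (yes _)  eq = injective f eq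
      shift-injective y z (yes o) (no ¬o)  eq = contradiction (step o (cong value eq)) ¬o
      shift-injective y z (no ¬o) (yes o)  eq = contradiction (step o (sym (cong value eq))) ¬o
      shift-injective y z (no _)  (no _)   eq = cong value eq

      shift-surjective : ∀ z → Dec (Orbit (value z)) → ∃[ y ] (∀ o → shift y o ≡ z)
      shift-surjective z (yes (outside z≮x)) = contradiction (below W z) z≮x
      shift-surjective z (yes (step {y} o fy≡z)) = y , λ where
        (yes _) → value-injective fy≡z
        (no ¬o) → contradiction o ¬o
      shift-surjective z (no ¬o) = value z , λ where
        (yes o) → contradiction o ¬o
        (no _)  → value-injective refl

    segment-bijection : A ⤖ (W ↾ x)
    segment-bijection = mk⤖ {to = λ y → shift y em}
      ( (λ {y} {z} → shift-injective y z em em)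
      , λ z → let y , hits = shift-surjective z em in y , λ { refl → hits em } )

  -- The square of an infinite segment of a well-order

  module _ (W : WellOrder A) where
    private
      open module W = WellOrder W using (_<_; <-trans; irrefl)

      _≤_ : Rel A 0ℓ
      x ≤ y = x < y ⊎ x ≡ y

      ≤-trans : Transitive _≤_
      ≤-trans (inj₁ x<y)  (inj₁ y<z)  = inj₁ (<-trans x<y y<z)
      ≤-trans (inj₁ x<y)  (inj₂ refl) = inj₁ x<y
      ≤-trans (inj₂ refl) y≤z         = y≤z

      max : A → A → A
      max x y with W.connex x y
      ... | inj₁ _ = y
      ... | inj₂ _ = x

      ≤-maxˡ : ∀ x y → x ≤ max x y
      ≤-maxˡ x y with W.connex x y
      ... | inj₁ x<y = inj₁ x<y
      ... | inj₂ _   = inj₂ refl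

      ≤-maxʳ : ∀ x y → y ≤ max x y
      ≤-maxʳ x y with W.connex x y
      ... | inj₁ _           = inj₂ refl
      ... | inj₂ (inj₁ refl) = inj₂ refl
      ... | inj₂ (inj₂ y<x)  = inj₁ y<x

      max-< : ∀ {x y z} → x < z → y < z → max x y < z
      max-< {x} {y} x<z y<z with W.connex x y
      ... | inj₁ _ = y<z
      ... | inj₂ _ = x<z

      segment-inclusion-≤ : ∀ {x y} → x ≤ y → (W ↾ x) ↣ (W ↾ y)
      segment-inclusion-≤ (inj₁ x<y)  = segment-inclusion W x<y
      segment-inclusion-≤ (inj₂ refl) = ↣-id _

      -- The closed segment at w is the open one with one more point.
      toMaybe : ∀ {w} x → x ≤ w → Maybe (W ↾ w)
      toMaybe x (inj₁ x<w) = just (x , [ x<w ])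
      toMaybe x (inj₂ _)   = nothing

      toMaybe-injective : ∀ {w x y} (p : x ≤ w) (q : y ≤ w) → toMaybe x p ≡ toMaybe y q → x ≡ y
      toMaybe-injective (inj₁ _)    (inj₁ _)    refl = refl
      toMaybe-injective (inj₂ refl) (inj₂ refl) _    = refl

    -- Gödel's order on the square of a segment compares the maxima first, then
    -- the pairs lexicographically.  All predecessors of a pair lie in the
    -- square of the closed segment at its maximum.
    private module _ (x : A) where
      key : ((W ↾ x) × (W ↾ x)) ↣ (A × A × A)
      key = mk↣ {to = λ (a , b) → max (value a) (value b) , value a , value b} λ eq →
        cong₂ _,_ (value-injective (cong (proj₁ ∘ proj₂) eq))
                  (value-injective (cong (proj₂ ∘ proj₂) eq))

      gödel : WellOrder ((W ↾ x) × (W ↾ x))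
      gödel = pullback (W ⊗ (W ⊗ W)) key

      gödel-max : ∀ p q → WellOrder._<_ gödel q p → proj₁ (to key q) ≤ proj₁ (to key p)
      gödel-max _ _ (inj₁ q<p)       = inj₁ q<p
      gödel-max _ _ (inj₂ (q≡p , _)) = inj₂ q≡p

      gödel-segment : ∀ {w} p → proj₁ (to key p) ≤ w → (gödel ↾ p) ↣ (Maybe (W ↾ w) × Maybe (W ↾ w))
      gödel-segment {w} p p≤w = mk↣
        {to = λ q → toMaybe _ (left q) , toMaybe _ (right q)}
        λ {q} {q′} eq → value-injective (cong₂ _,_
          (value-injective (toMaybe-injective (left q) (left q′) (cong proj₁ eq)))
          (value-injective (toMaybe-injective (right q) (right q′) (cong proj₂ eq))))
        where
        left : (q : gödel ↾ p) → value (proj₁ (value q)) ≤ w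
        left q = ≤-trans (≤-maxˡ _ _) (≤-trans (gödel-max p (value q) (below gödel {x = p} q)) p≤w)

        right : (q : gödel ↾ p) → value (proj₂ (value q)) ≤ w
        right q = ≤-trans (≤-maxʳ _ _) (≤-trans (gödel-max p (value q) (below gödel {x = p} q)) p≤w)

    -- If all segments below x are finite, then x is at most ω.  Otherwise, if x²
    -- does not inject into x, then x injects into a proper segment of Gödel's
    -- order, hence into the square of an infinite 1 + w with w < x, and the
    -- square of w injects into w by induction.
    segment-square : ∀ x → ℕ ↣ (W ↾ x) → ((W ↾ x) × (W ↾ x)) ↣ (W ↾ x)
    segment-square x = go x (W.wellFounded x)
      where
      go : ∀ x → Acc _<_ x → ℕ ↣ (W ↾ x) → ((W ↾ x) × (W ↾ x)) ↣ (W ↾ x)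
      go x (acc rs) ℕ↣x with em {∃[ y ] (y < x × (ℕ ↣ (W ↾ y)))}
      ... | no ¬∃ with compare (segment-order W x) ℕ-wellOrder
      ...   | inj₁ x↣ℕ = ↣-trans (x↣ℕ ×-↣ x↣ℕ) (↣-trans ℕ-pairing ℕ↣x)
      ...   | inj₂ (y , ℕ↣y) = contradiction
                (value y , below W y , ↣-trans ℕ↣y (segment-segment W y)) ¬∃
      go x (acc rs) ℕ↣x | yes (y , y<x , ℕ↣y) with compare (gödel x) (segment-order W x)
      ... | inj₁ x²↣x = x²↣x
      ... | inj₂ (p@(a , b) , x↣p) =
        ↣-trans (x↣w ×-↣ x↣w) (↣-trans w²↣w (segment-inclusion W w<x))
        where
        w : A
        w = max y (max (value a) (value b))

        w<x : w < x
        w<x = max-< y<x (max-< (below W a) (below W b))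

        ℕ↣w : ℕ ↣ (W ↾ w)
        ℕ↣w = ↣-trans ℕ↣y (segment-inclusion-≤ (≤-maxˡ _ _))

        w²↣w : ((W ↾ w) × (W ↾ w)) ↣ (W ↾ w)
        w²↣w = go w (rs w<x) ℕ↣w

        1+w↣w : Maybe (W ↾ w) ↣ (W ↾ w)
        1+w↣w = ↣-trans (Maybe-↣ ℕ↣w) w²↣w

        x↣w : (W ↾ x) ↣ (W ↾ w)
        x↣w = ↣-trans x↣p (↣-trans (gödel-segment x p (≤-maxʳ y _))
                (↣-trans (1+w↣w ×-↣ 1+w↣w) w²↣w))

  -- Arithmetic of a cardinal and its successor

  module _ (κ κ⁺ : Cardinal) (ℕ↣κ : Infinite κ) (succ : κ⁺ IsSuccessorOf κ) where
    private
      V : WellOrder ∣ κ ∣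
      V = well-order κ

      W : WellOrder ∣ κ⁺ ∣
      W = well-order κ⁺

      open module W = WellOrder W using (_<_)

    -- A segment that does not inject into κ, while all smaller ones do, is itself
    -- a cardinal above κ.  So κ⁺ injects into it, and is equinumerous with one of
    -- its own segments.
    successor-segment : ∀ x → (W ↾ x) ↣ ∣ κ ∣
    successor-segment x = go x (W.wellFounded x)
      where
      go : ∀ x → Acc _<_ x → (W ↾ x) ↣ ∣ κ ∣
      go x (acc rs) = by-contradiction λ x↣̸κ →
        let μ : Cardinal
            μ = record
              { Carrier            = W ↾ x
              ; _<_                = WellOrder._<_ (segment-order W x)
              ; isStrictTotalOrder = isStrictTotalOrder (segment-order W x)
              ; <-wellFounded      = wellFounded (segment-order W x)
              ; initial            = λ y x⤖y → x↣̸κ (↣-trans (Bijection.injection x⤖y)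
                  (↣-trans (segment-segment W y) (go (value y) (rs (below W y)))))
              }

            κ≤μ : κ ≤ᶜ μ
            κ≤μ = case compare (segment-order W x) V of λ where
              (inj₁ x↣κ)       → contradiction x↣κ x↣̸κ
              (inj₂ (y , κ↣y)) → ↣-trans κ↣y (mk↣ {to = value} value-injective)
        in Cardinal.initial κ⁺ x (segment-bijection W (proj₂ succ μ (κ≤μ , x↣̸κ)))

    -- κ is equinumerous with an infinite segment of κ⁺.
    square : (∣ κ ∣ × ∣ κ ∣) ↣ ∣ κ ∣
    square with compare W V
    ... | inj₁ κ⁺↣κ      = contradiction κ⁺↣κ (proj₂ (proj₁ succ))
    ... | inj₂ (x , κ↣x) = ↣-trans (κ↣x ×-↣ κ↣x)
      (↣-trans (segment-square W x (↣-trans ℕ↣κ κ↣x)) (successor-segment x))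

  -- Constructions of linear orders

  strictly-monotone⇒embedding : (L : LO A) (L′ : LO B) {f : A → B} →
    (∀ x y → LO._<_ L x y → LO._<_ L′ (f x) (f y)) → IsEmbedding L L′ f
  strictly-monotone⇒embedding L L′ {f} f-strict x y = mk⇔ mono reflect
    where
    module L  = LO L
    module L′ = LO L′

    mono : ∀ {x y} → x L.≤ y → f x L′.≤ f y
    mono {x} {y} x≤y with em {x ≡ y}
    ... | yes refl = IsTotalOrder.refl L′.isTotalOrder
    ... | no  x≢y  = proj₁ (f-strict x y (x≤y , x≢y))

    reflect : f x L′.≤ f y → x L.≤ y
    reflect fx≤fy with IsTotalOrder.total L.isTotalOrder x y | em {x ≡ y}
    ... | inj₁ x≤y | _        = x≤y
    ... | inj₂ _   | yes refl = IsTotalOrder.refl L.isTotalOrder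
    ... | inj₂ y≤x | no  x≢y  =
      contradiction fx≤fy (<⇒≱ L′ (f-strict y x (y≤x , x≢y ∘ sym)))

  -- The sum over I of the orders F i, all on the same domain A.
  ∑ : LO B → (B → LO A) → LO (B × A)
  ∑ {B} {A} I F = record
    { _≤_          = _≤_
    ; isTotalOrder = record
      { isPartialOrder = record
        { isPreorder = record
          { isEquivalence = isEquivalence
          ; reflexive     = λ { refl → inj₂ (refl , F.refl _) }
          ; trans         = ≤-trans
          }
        ; antisym = ≤-antisym
        }
      ; total = ≤-total
      }
    }
    where
    module I = LO I
    module I-order = IsTotalOrder I.isTotalOrder
    module F i = IsTotalOrder (LO.isTotalOrder (F i))

    _≤_ : Rel (B × A) 0ℓ
    (i , a) ≤ (j , b) = i I.< j ⊎ (i ≡ j × LO._≤_ (F i) a b)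

    ≤-trans : Transitive _≤_
    ≤-trans (inj₁ i<j)        (inj₁ j<k)        =
      inj₁ (ToStrict.<-trans _≡_ I._≤_ I-order.isPartialOrder i<j j<k)
    ≤-trans (inj₁ i<j)        (inj₂ (refl , _)) = inj₁ i<j
    ≤-trans (inj₂ (refl , _)) (inj₁ i<k)        = inj₁ i<k
    ≤-trans (inj₂ (refl , p)) (inj₂ (refl , q)) = inj₂ (refl , F.trans _ p q)

    ≤-antisym : ∀ {p q} → p ≤ q → q ≤ p → p ≡ q
    ≤-antisym (inj₁ i<j)        (inj₁ j<i)        = contradiction (proj₁ j<i) (<⇒≱ I i<j)
    ≤-antisym (inj₁ i<j)        (inj₂ (refl , _)) = contradiction refl (proj₂ i<j)
    ≤-antisym (inj₂ (refl , _)) (inj₁ i<i)        = contradiction refl (proj₂ i<i)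
    ≤-antisym (inj₂ (refl , p)) (inj₂ (_ , q))    = cong (_ ,_) (F.antisym _ p q)

    ≤-total : ∀ p q → p ≤ q ⊎ q ≤ p
    ≤-total (i , a) (j , b) with em {i ≡ j}
    ... | yes refl with F.total i a b
    ...   | inj₁ a≤b = inj₁ (inj₂ (refl , a≤b))
    ...   | inj₂ b≤a = inj₂ (inj₂ (refl , b≤a))
    ≤-total (i , a) (j , b) | no i≢j with I-order.total i j
    ...   | inj₁ i≤j = inj₁ (inj₁ (i≤j , i≢j))
    ...   | inj₂ j≤i = inj₂ (inj₁ (j≤i , i≢j ∘ sym))

  summand : (I : LO B) (F : B → LO A) (i : B) → F i ⊑ ∑ I F
  summand I F i = record
    { map    = i ,_
    ; embeds = λ _ _ → mk⇔ (λ a≤b → inj₂ (refl , a≤b)) λ where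
        (inj₁ i<i)       → contradiction refl (proj₂ i<i)
        (inj₂ (_ , a≤b)) → a≤b
    ; convex = λ where
        a c (j , b) (inj₂ (refl , _)) _                 → b , refl
        a c (j , b) (inj₁ i<j)        (inj₂ (refl , _)) → b , refl
        a c (j , b) (inj₁ i<j)        (inj₁ j<i)        →
          contradiction (proj₁ j<i) (<⇒≱ I i<j)
    }

  -- The order on B that has a copy of L on the range of j, followed by the
  -- remaining points in the order of L′.
  module Extend (L : LO A) (j : A ↣ B) (L′ : LO B) where
    private
      locate′ : (y : B) → Dec (∃[ a ] to j a ≡ y) → A ⊎ B
      locate′ y (yes (a , _)) = inj₁ a
      locate′ y (no  _)       = inj₂ y

      locate′-injective : ∀ {y z} d e → locate′ y d ≡ locate′ z e → y ≡ z
      locate′-injective (yes (a , ja≡y)) (yes (b , jb≡z)) eq =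
        trans (sym ja≡y) (trans (cong (to j) (inj₁-injective eq)) jb≡z)
      locate′-injective (no _) (no _) eq = inj₂-injective eq

      locate′-j : ∀ a d → locate′ (to j a) d ≡ inj₁ a
      locate′-j a (yes (b , jb≡ja)) = cong inj₁ (injective j jb≡ja)
      locate′-j a (no  ∄)           = contradiction (a , refl) ∄

      locate : B ↣ (A ⊎ B)
      locate = mk↣ {to = λ y → locate′ y em} (locate′-injective em em)

    extend : LO B
    extend = pullback-LO (L ⊕ L′) locate

    extend-⊑ : L ⊑ extend
    extend-⊑ = record
      { map    = to j
      ; embeds = embeds
      ; convex = λ a c y _ → initial c y em
      }
      where
      embeds : IsEmbedding L extend (to j)
      embeds a b rewrite locate′-j a em | locate′-j b em = mk⇔ ₁∼₁ drop-inj₁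

      initial : ∀ c y d → (LO._≤_ L ⊎-< LO._≤_ L′) (locate′ y d) (to locate (to j c)) →
                ∃[ b ] to j b ≡ y
      initial c y (yes b) _ = b
      initial c y (no _) y≤jc rewrite locate′-j c em with () ← y≤jc

  open Extend public using (extend; extend-⊑)

  -- The orders 1 + x + ω*

  module Block (W : WellOrder A) where
    private
      open module W = WellOrder W using (_<_)

    -- The least point, the points below x, and the points of ω*.
    Points : A → Set
    Points x = ⊤ ⊎ ((W ↾ x) ⊎ ℕ)

    -- The order 1 + x + ω*, for x the order type of the segment below x.  The
    -- point desc (n + 1) lies below desc n.
    block : (x : A) → LO (Points x)
    block x = one ⊕ (linear (segment-order W x) ⊕ ω*)

    pattern base   = inj₁ tt
    pattern ord y  = inj₂ (inj₁ y)
    pattern desc n = inj₂ (inj₂ n)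

    base-least : ∀ x a → LO._≤_ (block x) base a
    base-least x base     = ₁∼₁ tt
    base-least x (inj₂ _) = ₁∼₂

    module _ {L : LO B} where
      private
        open module L = LO L using (_≤_) renaming (_<_ to _≺_)
        module L-order = IsTotalOrder L.isTotalOrder

      -- Suppose that f and g start at the same point and agree below y.  Then
      -- the only points that f sends below the image of y under g are the base
      -- and the points before y.
      module _ {x x′} (f : block x ⊑ L) (g : block x′ ⊑ L) (start : map f base ≡ map g base)
               (y : W ↾ x′) (y⊆x : ∀ {z} → z < value y → z < x)
               (agree : ∀ (z : W ↾ x) (z′ : W ↾ x′) → value z ≡ value z′ → value z < value y →
                        map f (ord z) ≡ map g (ord z′))
        where
        private
          module g = _⊑_ g

        passed : ∀ a → map f a ≺ map g (ord y) →
                 a ≡ base ⊎ (∃[ z ] (value z < value y × a ≡ ord z))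
        passed a fa<gy with convex g base (ord y) (map f a) g-start≤fa (proj₁ fa<gy)
          where
          g-start≤fa : map g base ≤ map f a
          g-start≤fa = subst (_≤ map f a) start (_⊑_.mono f (base-least x a))
        ... | base , g-base≡fa =
          inj₁ (sym (_⊑_.map-injective f (trans start g-base≡fa)))
        ... | ord z , gz≡fa with g.reflect (subst (_≤ map g (ord y)) (sym gz≡fa) (proj₁ fa<gy))
        ...   | ₂∼₂ (₁∼₁ (inj₁ z<y)) =
          inj₂ (z′ , z<y , sym (_⊑_.map-injective f (trans (agree z′ z refl z<y) gz≡fa)))
          where
          z′ : W ↾ x
          z′ = value z , [ y⊆x z<y ]
        ...   | ₂∼₂ (₁∼₁ (inj₂ refl)) = contradiction (sym gz≡fa) (proj₂ fa<gy)
        passed a fa<gy | desc n , gn≡fa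
          with g.reflect (subst (_≤ map g (ord y)) (sym gn≡fa) (proj₁ fa<gy))
        ... | ₂∼₂ ()

      -- Convex copies with the same start run in parallel on their well-ordered
      -- parts: at a first disagreement, the copy that is ahead would have skipped
      -- a point.
      agreement : ∀ {x x′} (f : block x ⊑ L) (g : block x′ ⊑ L) → map f base ≡ map g base →
                  (y : W ↾ x) (y′ : W ↾ x′) → value y ≡ value y′ → map f (ord y) ≡ map g (ord y′)
      agreement {x} {x′} f g start y = go (value y) (W.wellFounded _) y refl
        where
        go : ∀ v → Acc _<_ v → (y : W ↾ x) → value y ≡ v → (y′ : W ↾ x′) → value y ≡ value y′ →
             map f (ord y) ≡ map g (ord y′)
        go v (acc rs) y refl y′ refl with em {map f (ord y) ≡ map g (ord y′)}
        ... | yes eq = eq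
        ... | no  fy≢gy with L-order.total (map f (ord y)) (map g (ord y′))
        ...   | inj₁ fy≤gy with passed f g start y′
                  (λ z<y → W.<-trans z<y (below W y))
                  (λ z z′ eq z<y → go (value z) (rs z<y) z refl z′ eq)
                  (ord y) (fy≤gy , fy≢gy)
        ...     | inj₂ (_ , z<y , refl) = contradiction z<y W.irrefl
        go v (acc rs) y refl y′ refl | no fy≢gy | inj₂ gy≤fy with passed g f (sym start) y
                  (λ z<y → W.<-trans z<y (below W y′))
                  (λ z z′ eq z<y → sym (go (value z′) (rs (subst (_< value y) eq z<y)) z′ refl z (sym eq)))
                  (ord y′) (gy≤fy , fy≢gy ∘ sym)
        ... | inj₂ (_ , z<y , refl) = contradiction z<y W.irrefl

      -- Let y be the point x of the longer block.  No point of the shorter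
      -- block's ω* is sent below the image of y, so by convexity the shorter copy
      -- contains that image.  It is not the image of the base or of a point
      -- before x, which the longer copy attains earlier, and it is not the image
      -- of desc n, since desc (n + 1) would then be sent below it.
      starts-differ : ∀ {x x′} (f : block x ⊑ L) (g : block x′ ⊑ L) → x < x′ →
                      map f base ≢ map g base
      starts-differ {x} {x′} f g x<x′ start =
        case convex f base (desc 0) (map g (ord y)) f-start≤gy (gy≤f 0) of λ where
          (base , eq) → case _⊑_.map-injective g (trans (sym start) eq) of λ ()
          (ord z , eq) →
            let z′ = value z , [ W.<-trans (below W z) x<x′ ]
                z≡y = _⊑_.map-injective g (trans (sym (agreement f g start z z′ refl)) eq)
            in W.irrefl (subst (_< x) (cong value (ord-injective z≡y)) (below W z))
          (desc n , eq) → ℕ.<-irrefl refl (desc-reflect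
            (_⊑_.reflect f (subst (_≤ map f (desc (suc n))) (sym eq) (gy≤f (suc n)))))
        where
        y : W ↾ x′
        y = x , [ x<x′ ]

        ord-injective : ∀ {z z′ : W ↾ x′} →
          _≡_ {A = Points x′} (ord z) (ord z′) → z ≡ z′
        ord-injective refl = refl

        desc-reflect : ∀ {m n} → LO._≤_ (block x) (desc m) (desc n) → n ℕ.≤ m
        desc-reflect (₂∼₂ (₂∼₂ n≤m)) = n≤m

        f-start≤gy : map f base ≤ map g (ord y)
        f-start≤gy = subst (_≤ map g (ord y)) (sym start) (_⊑_.mono g (base-least x′ _))

        gy≤f : ∀ n → map g (ord y) ≤ map f (desc n)
        gy≤f n with L-order.total (map g (ord y)) (map f (desc n)) | em {map f (desc n) ≡ map g (ord y)}
        ... | inj₁ gy≤fn | _       = gy≤fn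
        ... | inj₂ _     | yes eq  = L-order.reflexive (sym eq)
        ... | inj₂ fn≤gy | no  neq
          with passed f g start y (λ z<x → z<x) (λ z z′ eq _ → agreement f g start z z′ eq)
                 (desc n) (fn≤gy , neq)
        ...   | inj₁ ()
        ...   | inj₂ (_ , _ , ())

      start-determines : ∀ {x x′} (f : block x ⊑ L) (g : block x′ ⊑ L) →
                         map f base ≡ map g base → x ≡ x′
      start-determines {x} {x′} f g start with W.connex x x′
      ... | inj₁ x<x′        = contradiction start (starts-differ f g x<x′)
      ... | inj₂ (inj₁ x≡x′) = x≡x′
      ... | inj₂ (inj₂ x′<x) = contradiction (sym start) (starts-differ g f x′<x)

  open Block public

  -- Piecewise convex embeddings

  module _ {κ : Cardinal} {ℓ : Level} (𝓛 : Pred (Lin κ) ℓ) (closed : DownwardClosed 𝓛) where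

    -- Let L contain a convex sum, over an order M outside 𝓛, of orders with a
    -- least point.  If the pieces separated these least points, then M would
    -- embed into the order of the pieces.  So some piece contains two of them,
    -- and with them a whole summand.
    summand-survives : (M : Lin κ) → M ∉ 𝓛 →
      (F : ∣ Lin.size M ∣ → LO A) (bottom : ∣ Lin.size M ∣ → A) →
      (∀ m a → LO._≤_ (F m) (bottom m) a) →
      {L : LO B} {L′ : LO C} → ∑ (Lin.order M) F ⊑ L → L ⊴[ 𝓛 ] L′ → ∃[ m ] (F m ⊑ L′)
    summand-survives M M∉𝓛 F bottom bottom-least {L} {L′} j
      (K , K∈𝓛 , P , partition , f , f-embeds , f-convex) =
      by-contradiction λ none → M∉𝓛 (closed M K (piece , strictly-monotone⇒embedding M.order K.order
        (piece-strict none)) K∈𝓛)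
      where
      module M = Lin M
      module K = Lin K
      module M-order = LO M.order
      module K-order = LO K.order
      module L′ = LO L′
      module L′-order = IsTotalOrder L′.isTotalOrder
      module partition = IsConvexPartition partition

      point : ∣ M.size ∣ → _
      point m = map j (m , bottom m)

      piece : ∣ M.size ∣ → ∣ K.size ∣
      piece m = proj₁ (partition.covers (point m))

      point∈piece : ∀ m → point m ∈ P (piece m)
      point∈piece m = proj₂ (partition.covers (point m))

      mono : ∀ {x y} → LO._≤_ L x y → f x L′.≤ f y
      mono = Equivalence.to (f-embeds _ _)

      reflect : ∀ {x y} → f x L′.≤ f y → LO._≤_ L x y
      reflect = Equivalence.from (f-embeds _ _)

      same-piece : ∀ {m m′} → m M-order.< m′ → piece m ≡ piece m′ → F m ⊑ L′
      same-piece {m} {m′} m<m′ same = record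
        { map    = f ∘ map copy
        ; embeds = λ _ _ → mk⇔ (mono ∘ _⊑_.mono copy) (_⊑_.reflect copy ∘ reflect)
        ; convex = convex′
        }
        where
        copy : F m ⊑ L
        copy = ⊑-trans (summand M.order F m) j

        convex′ : ∀ a c y → f (map copy a) L′.≤ y → y L′.≤ f (map copy c) →
                  ∃[ b ] f (map copy b) ≡ y
        convex′ a c y a≤y y≤c
          with f-convex (piece m) (f (point m)) y (f (point m′))
                 (L′-order.trans (mono (_⊑_.mono copy (bottom-least m a))) a≤y)
                 (L′-order.trans y≤c (mono (_⊑_.mono j (inj₁ m<m′))))
                 (point m , point∈piece m , refl)
                 (point m′ , subst (λ k → point m′ ∈ P k) (sym same) (point∈piece m′) , refl)
        ... | z , _ , refl with convex copy a c z (reflect a≤y) (reflect y≤c)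
        ...   | b , refl = b , refl

      piece-strict : ¬ (∃[ m ] (F m ⊑ L′)) → ∀ m m′ → m M-order.< m′ → piece m K-order.< piece m′
      piece-strict none m m′ m<m′ with IsTotalOrder.total K-order.isTotalOrder (piece m) (piece m′)
      ... | inj₁ k≤k′ = k≤k′ , λ same → none (m , same-piece m<m′ same)
      ... | inj₂ k′≤k = contradiction (_⊑_.mono j (inj₁ m<m′)) (<⇒≱ L
        (Equivalence.to (partition.ordered (piece m′) (piece m))
          (k′≤k , λ same → none (m , same-piece m<m′ (sym same)))
          (point m′) (point m) (point∈piece m′) (point∈piece m)))

    -- The cardinal 1.
    one-Cardinal : Cardinal
    one-Cardinal = record
      { Carrier            = ⊤
      ; _<_                = λ _ _ → ⊥
      ; isStrictTotalOrder = record
        { isStrictPartialOrder = record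
          { isEquivalence = isEquivalence
          ; irrefl        = λ _ ()
          ; trans         = λ ()
          ; <-resp-≈      = (λ _ ()) , (λ _ ())
          }
        ; compare = λ _ _ → tri≈ (λ ()) refl (λ ())
        }
      ; <-wellFounded      = λ _ → acc λ ()
      ; initial            = λ _ ⊤⤖∅ → empty (Bijection.to ⊤⤖∅ tt)
      }
      where
      empty : ¬ [ y ∈ ⊤ ∣ ⊥ ]
      empty (_ , [ () ])

    -- The order with one point; the argument witnesses that 1 is at most κ.
    one-Lin : ∣ κ ∣ → Lin κ
    one-Lin a = record
      { size     = one-Cardinal
      ; size≤κ   = mk↣ {to = λ _ → a} λ _ → refl
      ; nonempty = tt
      ; order    = one
      }

    -- A convex embedding is piecewise convex for the partition with one piece,
    -- which is available since 𝓛 has an element.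
    ⊑⇒⊴ : Satisfiable 𝓛 → {L L′ : LO ∣ κ ∣} → ∣ κ ∣ → L ⊑ L′ → L ⊴[ 𝓛 ] L′
    ⊑⇒⊴ (K , K∈𝓛) {L} {L′} a g =
      one-Lin a , closed (one-Lin a) K one⪯K K∈𝓛 ,
      (λ _ _ → ⊤) , partition , map g , _⊑_.embeds g , range-convex
      where
      one⪯K : one ⪯ Lin.order K
      one⪯K = (λ _ → Lin.nonempty K) ,
        λ _ _ → mk⇔ (λ _ → IsTotalOrder.refl (LO.isTotalOrder (Lin.order K))) (λ _ → tt)

      partition : IsConvexPartition one L (λ _ _ → ⊤)
      partition = record
        { nonempty = λ _ → a , tt
        ; covers   = λ _ → tt , tt
        ; disjoint = λ _ _ _ _ _ → refl
        ; ordered  = λ _ _ → mk⇔ (λ tt<tt → contradiction refl (proj₂ tt<tt))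
                                  (λ all< → contradiction refl (proj₂ (all< a a tt tt)))
        }

      range-convex : ∀ k → Convex L′ (Image (map g) (λ _ → ⊤))
      range-convex _ _ y _ x≤y y≤z (b , _ , refl) (c , _ , refl) =
        let d , gd≡y = convex g b c y x≤y y≤z in d , tt , gd≡y

  -- The bounds

  module _ (κ : Cardinal) (ℕ↣κ : Infinite κ) (κ²↣κ : (∣ κ ∣ × ∣ κ ∣) ↣ ∣ κ ∣) where

    -- At most κ orders on κ have a common bound: their sum, continued by the
    -- unused points of κ.
    sum-bounds : (ν : Cardinal) → ν ≤ᶜ κ → (F : ∣ ν ∣ → LO ∣ κ ∣) → ∃[ L ] (∀ i → F i ⊑ L)
    sum-bounds ν ν≤κ F = extend L code (linear (well-order κ)) ,
      λ i → ⊑-trans (summand (linear (well-order ν)) F i) (extend-⊑ L code _)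
      where
      L : LO (∣ ν ∣ × ∣ κ ∣)
      L = ∑ (linear (well-order ν)) F

      code : (∣ ν ∣ × ∣ κ ∣) ↣ ∣ κ ∣
      code = ↣-trans (ν≤κ ×-↣ ↣-id _) κ²↣κ

    ⊎-↣ : A ↣ ∣ κ ∣ → B ↣ ∣ κ ∣ → (A ⊎ B) ↣ ∣ κ ∣
    ⊎-↣ f g = ↣-trans (mk↣ {to = tag} (λ {x} {y} → tag-injective x y)) κ²↣κ
      where
      tag : _ → ∣ κ ∣ × ∣ κ ∣
      tag (inj₁ a) = to ℕ↣κ 0 , to f a
      tag (inj₂ b) = to ℕ↣κ 1 , to g b

      tag-injective : ∀ x y → tag x ≡ tag y → x ≡ y
      tag-injective (inj₁ _) (inj₁ _) eq = cong inj₁ (injective f (cong proj₂ eq))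
      tag-injective (inj₁ _) (inj₂ _) eq with () ← injective ℕ↣κ (cong proj₁ eq)
      tag-injective (inj₂ _) (inj₁ _) eq with () ← injective ℕ↣κ (cong proj₁ eq)
      tag-injective (inj₂ _) (inj₂ _) eq = cong inj₂ (injective g (cong proj₂ eq))


    -- The unbounded family: the member at x has M copies of 1 + x + ω* as an
    -- initial segment, followed by the unused points of κ.
    module Family (W : WellOrder A) (segments : ∀ x → (W ↾ x) ↣ ∣ κ ∣) (M : Lin κ) where
      private
        module M = Lin M

        -- The code of a base does not depend on x.
        code : ∀ x → (∣ M.size ∣ × Points W x) ↣ ∣ κ ∣
        code x = ↣-trans
          (M.size≤κ ×-↣ ⊎-↣ (mk↣ {to = λ _ → to ℕ↣κ 0} λ _ → refl) (⊎-↣ (segments x) ℕ↣κ)) κ²↣κ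

      -- M copies of 1 + x + ω*.
      copies : ∀ x → LO (∣ M.size ∣ × Points W x)
      copies x = ∑ M.order (λ _ → block W x)

      member : A → LO ∣ κ ∣
      member x = extend (copies x) (code x) (linear (well-order κ))

      copies-⊑ : ∀ x → copies x ⊑ member x
      copies-⊑ x = extend-⊑ (copies x) (code x) (linear (well-order κ))

      -- A copy of 1 + x + ω* starts at the same point of κ in every member.
      member-injective : ∀ {x y} → Setoid._≈_ (LO-setoid ∣ κ ∣) (member x) (member y) → x ≡ y
      member-injective {x} {y} eq = start-determines W (⊑-trans (first x) (≈⇒⊑ eq)) (first y) refl
        where
        first : ∀ x → block W x ⊑ member x
        first x = ⊑-trans (summand M.order (λ _ → block W x) M.nonempty) (copies-⊑ x)

theorem8p9 : (∀ {ℓ} → ExcludedMiddle ℓ) →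
    (κ κ⁺ : Cardinal) → Infinite κ → κ⁺ IsSuccessorOf κ →
    {ℓ : Level} (𝓛 : Pred (Lin κ) ℓ) →
    𝓛 ⊂ U → Satisfiable 𝓛 → DownwardClosed 𝓛 → Transitive (⊴-on κ 𝓛) →
    (Σ[ 𝓕 ∈ Pred (LO ∣ κ ∣) 0ℓ ]
    HasSize (LO-setoid ∣ κ ∣) 𝓕 κ⁺ × Unbounded (LO-setoid ∣ κ ∣) (⊴-on κ 𝓛) 𝓕)
    × UnboundingNumber (LO-setoid ∣ κ ∣) (⊴-on κ 𝓛) κ⁺
theorem8p9 em κ κ⁺ ℕ↣κ succ 𝓛 (_ , U⊈𝓛) 𝓛-nonempty closed _ =
  unbounded-family , unbounded-family , unbounded⇒large
  where
  open Classical em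
  open Setoid (LO-setoid ∣ κ ∣) using (_≈_) renaming (refl to ≈-refl; sym to ≈-sym)

  W : WellOrder ∣ κ⁺ ∣
  W = well-order κ⁺

  κ²↣κ : (∣ κ ∣ × ∣ κ ∣) ↣ ∣ κ ∣
  κ²↣κ = square κ κ⁺ ℕ↣κ succ

  excluded : ∃[ M ] M ∉ 𝓛
  excluded = decidable-stable em λ none →
    U⊈𝓛 λ {M} _ → decidable-stable em λ M∉𝓛 → none (M , M∉𝓛)

  M : Lin κ
  M = proj₁ excluded

  open Family κ ℕ↣κ κ²↣κ W (successor-segment κ κ⁺ ℕ↣κ succ) M

  𝓕 : Pred (LO ∣ κ ∣) 0ℓ
  𝓕 L = ∃[ x ] member x ≈ L

  𝓕-unbounded : Unbounded (LO-setoid ∣ κ ∣) (⊴-on κ 𝓛) 𝓕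
  𝓕-unbounded (L , bound) = proj₂ (proj₁ succ)
    (mk↣ {to = λ x → map (copy x) base} λ {x} {y} → start-determines W (copy x) (copy y))
    where
    copy : ∀ x → block W x ⊑ L
    copy x = proj₂ (summand-survives 𝓛 closed M (proj₂ excluded) (λ _ → block W x)
      (λ _ → base) (λ _ → base-least W x) (copies-⊑ x)
      (bound (member x) (x , ≈-refl {member x})))

  unbounded-family : Σ[ 𝓕 ∈ Pred (LO ∣ κ ∣) 0ℓ ]
    HasSize (LO-setoid ∣ κ ∣) 𝓕 κ⁺ × Unbounded (LO-setoid ∣ κ ∣) (⊴-on κ 𝓛) 𝓕
  unbounded-family = 𝓕 , (member , member-injective , λ _ → mk⇔ (λ p → p) (λ p → p)) , 𝓕-unbounded

  unbounded⇒large : ∀ ν (𝓖 : Pred (LO ∣ κ ∣) 0ℓ) → HasSize (LO-setoid ∣ κ ∣) 𝓖 ν →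
                    Unbounded (LO-setoid ∣ κ ∣) (⊴-on κ 𝓛) 𝓖 → κ⁺ ≤ᶜ ν
  unbounded⇒large ν 𝓖 (e , _ , e-onto) unbounded with compare W (well-order ν)
  ... | inj₁ κ⁺≤ν      = κ⁺≤ν
  ... | inj₂ (x , ν↣x) = contradiction
    (L , λ y y∈𝓖 → let i , ei≈y = Equivalence.to (e-onto y) y∈𝓖 in
      ⊑⇒⊴ 𝓛 closed 𝓛-nonempty (to ℕ↣κ 0)
        (⊑-trans (≈⇒⊑ (≈-sym {e i} {y} ei≈y)) (e⊑L i)))
    unbounded
    where
    upper : ∃[ L ] (∀ i → e i ⊑ L)
    upper = sum-bounds κ ℕ↣κ κ²↣κ ν (↣-trans ν↣x (successor-segment κ κ⁺ ℕ↣κ succ x)) e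

    L : LO ∣ κ ∣
    L = proj₁ upper

    e⊑L : ∀ i → e i ⊑ L
    e⊑L = proj₂ upper
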